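{- Let $P$ and $Q$ be two image-finite process expressions. Then $P$ and $Q$ are stateless bisimilar if and only if for all valuations $V\in\mathcal{V}$ and all $\mathrm{HML}^{check+set}$ formulas $\phi$ we have $\langle P,V\rangle\in[\![\phi]\!]\Leftrightarrow\langle Q,V\rangle\in[\![\phi]\!]$.
   Context: **Process algebra with global variables.** Fix a data domain $D$, a finite set $Var$ of global variable names, a set $Act$ of actions, and a set $PN$ of process names. The transition labels are $TL = Act\cup\{assign(v,d)\mid v\in Var, d\in D\}$ (with $assign(v,d)$ formal labels). Process expressions (the set $\mathcal{P}$) are generated by $$P ::= \lambda.P \mid \delta \mid P+P \mid P\|P \mid \partial_B(P) \mid X \mid (v=d)\to P,$$ with $\lambda\in TL$, $B\subseteq Act$, $X\in PN$, $v\in Var$, $d\in D$. A recursive specification is fixed, containing exactly one equation $X\stackrel{\mathrm{def}}{=}t$ with $t\in\mathcal{P}$ for every $X\in PN$; it is guarded: in each equation $X\stackrel{\mathrm{def}}{=}t$ every occurrence of $X$ in $t$ is in the scope of an action prefix. A partial, commutative and associative function $\gamma:Act\times Act\rightharpoonup Act$ is fixed, such that if $\gamma(a,b)=c$ then $\gamma(c,d)$ is undefined for every $d$. A valuation is a function $V:Var\to D$; $\mathcal{V}$ is the set of valuations, and $V[v\mapsto d]$ is $V$ updated to map $v$ to $d$. States are pairs $\langle P,V\rangle\in\mathcal{P}\times\mathcal{V}$. The transition relation is the least relation closed under (with $a,b,c\in Act$, $\lambda\in TL$): - $\langle a.P,V\rangle\xrightarrow{a}\langle P,V\rangle$; $\langle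 assign(v,d).P,V\rangle\xrightarrow{assign(v,d)}\langle P,V[v\mapsto d]\rangle$; - if $\langle P,V\rangle\xrightarrow{\lambda}\langle P',V'\rangle$ then: $\langle (v=d)\to P,V\rangle\xrightarrow{\lambda}\langle P',V'\rangle$ provided $V(v)=d$; $\langle X,V\rangle\xrightarrow{\lambda}\langle P',V'\rangle$ provided $X\stackrel{\mathrm{def}}{=}P$; $\langle P+Q,V\rangle\xrightarrow{\lambda}\langle P',V'\rangle$ and $\langle Q+P,V\rangle\xrightarrow{\lambda}\langle P',V'\rangle$; $\langle P\|Q,V\rangle\xrightarrow{\lambda}\langle P'\|Q,V'\rangle$ and $\langle Q\|P,V\rangle\xrightarrow{\lambda}\langle Q\|P',V'\rangle$; $\langle\partial_B(P),V\rangle\xrightarrow{\lambda}\langle\partial_B(P'),V'\rangle$ provided $\lambda\notin B$; - if $\langle P,V\rangle\xrightarrow{a}\langle P',V\rangle$, $\langle Q,V\rangle\xrightarrow{b}\langle Q',V\rangle$ and $\gamma(a,b)=c$, then $\langle P\|Q,V\rangle\xrightarrow{c}\langle P'\|Q',V\rangle$. **Stateless bisimilarity.** $R\subseteq\mathcal{P}\times\mathcal{P}$ is a stateless bisimulation if $(P,Q)\in R$ implies, for all $\lambda\in TL$ and $V,V'\in\mathcal{V}$: whenever $\langle P,V\rangle\xrightarrow{\lambda}\langle P',V'\rangle$ there is $Q'$ with $\langle Q,V\rangle\xrightarrow{\lambda}\langle Q',V'\rangle$ and $(P',Q')\in R$; and whenever $\langle Q,V\rangle\xrightarrow{\lambda}\langle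 Q',V'\rangle$ there is $P'$ with $\langle P,V\rangle\xrightarrow{\lambda}\langle P',V'\rangle$ and $(P',Q')\in R$. $P$ and $Q$ are stateless bisimilar if some stateless bisimulation contains $(P,Q)$. **Image-finiteness.** $P'$ is reachable from $P$ if there are $n\ge 0$, expressions $P=P_0,\dots,P_n=P'$ and labels $\lambda_1,\dots,\lambda_n$ such that for each $i$ there exist valuations $V,V'$ (chosen independently for each $i$) with $\langle P_{i-1},V\rangle\xrightarrow{\lambda_i}\langle P_i,V'\rangle$. A state $\langle P,V\rangle$ is image-finite if for every label $\lambda$ the set $\{\langle P',V'\rangle\mid\langle P,V\rangle\xrightarrow{\lambda}\langle P',V'\rangle\}$ is finite. A process expression $P$ is image-finite if for every $P'$ reachable from $P$ and every valuation $V$ the state $\langle P',V\rangle$ is image-finite. **Logic $\mathrm{HML}^{check+set}$.** Formulas: $$\phi ::= true\mid false\mid (v=e)\mid\neg\phi\mid\phi\wedge\phi\mid\phi\vee\phi\mid\langle T\rangle\phi\mid[T]\phi\mid\ \downarrow(v:=e)\phi,$$ with $T$ a nonempty finite subset of $TL$, $v\in Var$, $e\in D$. With $S=\mathcal{P}\times\mathcal{V}$, the interpretation $[\![\phi]\!]\subseteq S$ is: $[\![true]\!]=S$, $[\![false]\!]=\emptyset$, $[\![v=e]\!]=\{\langle P,V\rangle\mid V(v)=e\}$; $\neg,\wedge,\vee$ are complement, intersection, union; $[\![\langle T\rangle\phi]\!]=\{u\mid\exists u'\in[\![\phi]\!],\lambda\in T: u\xrightarrow{\lambda}u'\}$; $[\![[T]\phi]\!]=\{u\mid\forall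 u'\in S,\lambda\in T: u\xrightarrow{\lambda}u'\Rightarrow u'\in[\![\phi]\!]\}$; $[\![\downarrow(v:=e)\phi]\!]=\{\langle P,V\rangle\mid\langle P,V[v\mapsto e]\rangle\in[\![\phi]\!]\}$. -}

module Defs where

open import Level using (0ℓ)
open import Data.Bool.Base using (Bool; T; if_then_else_)
open import Data.Empty using (⊥)
open import Data.Fin.Base using (Fin)
open import Data.Fin.Properties using (inj⇒≟)
open import Data.List.Base using (List)
open import Data.List.Membership.Propositional using () renaming (_∈_ to _∈ˡ_)
open import Data.List.NonEmpty.Base using (List⁺; toList)
open import Data.Maybe.Base using (Maybe; just; nothing; _>>=_)
open import Data.Nat.Base using (ℕ)
open import Data.Product.Base using (∃; ∃-syntax; _×_; _,_)
open import Function.Bundles using (_↔_; _⇔_)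
open import Function.Properties.Inverse using (↔⇒↣)
open import Relation.Binary.Core using (Rel)
open import Relation.Binary.Construct.Closure.ReflexiveTransitive using (Star)
open import Relation.Binary.Definitions using (DecidableEquality)
open import Relation.Binary.PropositionalEquality.Core using (_≡_; _≢_)
open import Relation.Nullary using (¬_)
open import Relation.Nullary.Decidable.Core using (does)
open import Relation.Unary using (Pred; _∈_; U; ∅; ∁; _∩_; _∪_)

-- The partial function γ is Maybe-valued, with nothing for "undefined";
-- associativity is the Kleene equality γ(γ(a,b),c) ≃ γ(a,γ(b,c)).
record Signature : Set₁ where
  field
    D Var Act PN : Set
    numVars      : ℕ
    Var↔Fin      : Var ↔ Fin numVars
    γ            : Act → Act → Maybe Act
    γ-comm       : ∀ a b → γ a b ≡ γ b a
    γ-assoc      : ∀ a b c → (γ a b >>= λ x → γ x c) ≡ (γ b c >>= λ y → γ a y)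
    γ-handshake  : ∀ {a b c} → γ a b ≡ just c → ∀ d → γ c d ≡ nothing

  _≟ᵛ_ : DecidableEquality Var
  _≟ᵛ_ = inj⇒≟ (↔⇒↣ Var↔Fin)

module Syntax (S : Signature) where
  open Signature S

  data TL : Set where
    act    : Act → TL
    assign : Var → D → TL

  -- A subset of Act is given by its characteristic function.
  ActSet : Set
  ActSet = Act → Bool

  infixr 8 _∙_
  infix  7 [_≐_]⇒_
  infixl 6 _∥_
  infixl 5 _⊕_

  data Process : Set where
    _∙_     : TL → Process → Process
    δ       : Process
    _⊕_     : Process → Process → Process
    _∥_     : Process → Process → Process
    ∂       : ActSet → Process → Process
    name    : PN → Process
    [_≐_]⇒_ : Var → D → Process → Process

  -- GuardedIn X P: every occurrence of X in P is in the scope of a prefix.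
  data GuardedIn (X : PN) : Process → Set where
    prefix : ∀ {α P} → GuardedIn X (α ∙ P)
    δ      : GuardedIn X δ
    _⊕_    : ∀ {P Q} → GuardedIn X P → GuardedIn X Q → GuardedIn X (P ⊕ Q)
    _∥_    : ∀ {P Q} → GuardedIn X P → GuardedIn X Q → GuardedIn X (P ∥ Q)
    ∂      : ∀ {B P} → GuardedIn X P → GuardedIn X (∂ B P)
    other  : ∀ {Y} → X ≢ Y → GuardedIn X (name Y)
    cond   : ∀ {v d P} → GuardedIn X P → GuardedIn X ([ v ≐ d ]⇒ P)

  Valuation : Set
  Valuation = Var → D

  infixl 9 _[_↦_]
  _[_↦_] : Valuation → Var → D → Valuation
  (V [ v ↦ d ]) w = if does (w ≟ᵛ v) then d else V w

  State : Set
  State = Process × Valuation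

  data Formula : Set where
    true false : Formula
    _≐_        : Var → D → Formula
    ¬′_        : Formula → Formula
    _∧_ _∨_    : Formula → Formula → Formula
    -- The list enumerates the finite set of labels; order and repetitions
    -- do not matter.
    ⟨_⟩_ [_]_  : List⁺ TL → Formula → Formula
    ↓[_:=_]_   : Var → D → Formula → Formula

record Specification (S : Signature) : Set where
  open Signature S using (PN)
  open Syntax S
  field
    def     : PN → Process
    guarded : ∀ X → GuardedIn X (def X)

module Semantics (S : Signature) (E : Specification S) where
  open Signature S
  open Syntax S public
  open Specification E

  _∈ᴮ_ : TL → ActSet → Set
  act a      ∈ᴮ B = T (B a)
  assign _ _ ∈ᴮ B = ⊥

  infix 4 _—[_]→_
  data _—[_]→_ : State → TL → State → Set where
    act    : ∀ {a P V} → (act a ∙ P , V) —[ act a ]→ (P , V)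
    assign : ∀ {v d P V} →
             (assign v d ∙ P , V) —[ assign v d ]→ (P , V [ v ↦ d ])
    cond   : ∀ {v d α P V P′ V′} → V v ≡ d →
             (P , V) —[ α ]→ (P′ , V′) →
             ([ v ≐ d ]⇒ P , V) —[ α ]→ (P′ , V′)
    name   : ∀ {X α V P′ V′} →
             (def X , V) —[ α ]→ (P′ , V′) →
             (name X , V) —[ α ]→ (P′ , V′)
    sumˡ   : ∀ {α P Q V P′ V′} →
             (P , V) —[ α ]→ (P′ , V′) →
             (P ⊕ Q , V) —[ α ]→ (P′ , V′)
    sumʳ   : ∀ {α P Q V P′ V′} →
             (P , V) —[ α ]→ (P′ , V′) →
             (Q ⊕ P , V) —[ α ]→ (P′ , V′)
    parˡ   : ∀ {α P Q V P′ V′} →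
             (P , V) —[ α ]→ (P′ , V′) →
             (P ∥ Q , V) —[ α ]→ (P′ ∥ Q , V′)
    parʳ   : ∀ {α P Q V P′ V′} →
             (P , V) —[ α ]→ (P′ , V′) →
             (Q ∥ P , V) —[ α ]→ (Q ∥ P′ , V′)
    encap  : ∀ {B α P V P′ V′} → ¬ (α ∈ᴮ B) →
             (P , V) —[ α ]→ (P′ , V′) →
             (∂ B P , V) —[ α ]→ (∂ B P′ , V′)
    comm   : ∀ {a b c P Q V P′ Q′} →
             (P , V) —[ act a ]→ (P′ , V) →
             (Q , V) —[ act b ]→ (Q′ , V) →
             γ a b ≡ just c →
             (P ∥ Q , V) —[ act c ]→ (P′ ∥ Q′ , V)

  StatelessBisimulation : Rel Process 0ℓ → Set
  StatelessBisimulation R = ∀ {P Q} → R P Q → ∀ α V V′ →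
    (∀ P′ → (P , V) —[ α ]→ (P′ , V′) →
       ∃[ Q′ ] ((Q , V) —[ α ]→ (Q′ , V′) × R P′ Q′))
    ×
    (∀ Q′ → (Q , V) —[ α ]→ (Q′ , V′) →
       ∃[ P′ ] ((P , V) —[ α ]→ (P′ , V′) × R P′ Q′))

  StatelessBisimilar : Process → Process → Set₁
  StatelessBisimilar P Q = ∃[ R ] (StatelessBisimulation R × R P Q)

  -- The valuations are existentially quantified in every single step, so
  -- consecutive steps of a path need not agree on them.
  Step : Rel Process 0ℓ
  Step P P′ = ∃[ α ] ∃[ V ] ∃[ V′ ] ((P , V) —[ α ]→ (P′ , V′))

  Reachable : Process → Process → Set
  Reachable = Star Step

  Finite : Pred State 0ℓ → Set
  Finite A = ∃ λ (xs : List State) → ∀ u → u ∈ A ⇔ u ∈ˡ xs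

  ImageFiniteState : State → Set
  ImageFiniteState u = ∀ α → Finite (λ u′ → u —[ α ]→ u′)

  ImageFinite : Process → Set
  ImageFinite P = ∀ P′ → Reachable P P′ → ∀ V → ImageFiniteState (P′ , V)

  ⟦_⟧ : Formula → Pred State 0ℓ
  ⟦ true ⟧         = U
  ⟦ false ⟧        = ∅
  ⟦ v ≐ e ⟧        = λ (P , V) → V v ≡ e
  ⟦ ¬′ φ ⟧         = ∁ ⟦ φ ⟧
  ⟦ φ ∧ ψ ⟧        = ⟦ φ ⟧ ∩ ⟦ ψ ⟧
  ⟦ φ ∨ ψ ⟧        = ⟦ φ ⟧ ∪ ⟦ ψ ⟧
  ⟦ ⟨ A ⟩ φ ⟧      = λ u → ∃[ u′ ] ∃[ α ]
                       (u′ ∈ ⟦ φ ⟧ × α ∈ˡ toList A × u —[ α ]→ u′)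
  ⟦ [ A ] φ ⟧      = λ u → ∀ u′ α → α ∈ˡ toList A → u —[ α ]→ u′ → u′ ∈ ⟦ φ ⟧
  ⟦ ↓[ v := e ] φ ⟧ = λ (P , V) → (P , V [ v ↦ e ]) ∈ ⟦ φ ⟧

{-# OPTIONS --safe #-}

-- Hennessy–Milner: among finitely many candidate successors Q′ of (Q , V), if
-- none is equivalent to P′, then each is separated from P′ by a formula at some
-- valuation W depending on Q′.  Assigning W to all of the finitely many
-- variables in front of that formula makes it separate at any valuation, in
-- particular at the one reached, and the diamond of the conjunction of these
-- formulas separates P from Q.
--
-- Without function extensionality, the assignments yield W only up to
-- pointwise equality, so formulas are shown to respect pointwise equality of
-- valuations.
module Submission where

open import Defs
open import Level using (0ℓ)
open import Axiom.DoubleNegationElimination using (em⇒dne)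
open import Axiom.ExcludedMiddle using (ExcludedMiddle)
open import Data.Bool.Base using (true; false)
open import Data.Empty using (⊥-elim)
open import Data.List.Base using (List; []; _∷_; foldr; map; allFin)
open import Data.List.Membership.Propositional using () renaming (_∈_ to _∈ˡ_; _∉_ to _∉ˡ_)
open import Data.List.Membership.Propositional.Properties using (∈-map⁺; ∈-allFin)
open import Data.List.NonEmpty.Base using (_∷_)
open import Data.List.Relation.Unary.Any using (here; there)
open import Data.Product.Base using (∃-syntax; _×_; _,_; proj₁; proj₂)
open import Data.Product.Function.NonDependent.Propositional using (_×-⇔_)
open import Data.Sum.Base using () renaming (map to ⊎-map)
open import Data.Sum.Function.Propositional using (_⊎-⇔_)
open import Function.Base using (_∘_)
open import Function.Bundles using (_⇔_; mk⇔; module Equivalence; module Inverse)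
open import Function.Construct.Identity using (⇔-id)
open import Function.Construct.Symmetry using (⇔-sym)
open import Function.Related.TypeIsomorphisms using (¬-cong-⇔)
open import Relation.Binary.Construct.Closure.ReflexiveTransitive using (ε; _◅_)
open import Relation.Binary.PropositionalEquality
  using (_≡_; _≗_; refl; sym; trans; subst)
open import Relation.Nullary using (¬_; does; proof; ofʸ; ofⁿ)
open import Relation.Unary using (_∈_; _∉_)

open Equivalence using (to; from)

module Properties (S : Signature) (E : Specification S) where
  open Signature S
  open Semantics S E

  effect : TL → Valuation → Valuation
  effect (act _)      V = V
  effect (assign v d) V = V [ v ↦ d ]

  -- Only prefixes act on the valuation, and the rules for composite processes pass their effect on.
  -- Hence transitions with the same label from the same valuation end in the same valuation.
  step-effect : ∀ {P V α P′ V′} → (P , V) —[ α ]→ (P′ , V′) → V′ ≡ effect α V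
  step-effect act         = refl
  step-effect assign      = refl
  step-effect (cond _ t)  = step-effect t
  step-effect (name t)    = step-effect t
  step-effect (sumˡ t)    = step-effect t
  step-effect (sumʳ t)    = step-effect t
  step-effect (parˡ t)    = step-effect t
  step-effect (parʳ t)    = step-effect t
  step-effect (encap _ t) = step-effect t
  step-effect (comm _ _ _) = refl

  update-cong : ∀ {V W} → V ≗ W → ∀ v d → V [ v ↦ d ] ≗ W [ v ↦ d ]
  update-cong V≗W v d w with does (w ≟ᵛ v)
  ... | true  = refl
  ... | false = V≗W w

  effect-cong : ∀ {V W} → V ≗ W → ∀ α → effect α V ≗ effect α W
  effect-cong V≗W (act _)      = V≗W
  effect-cong V≗W (assign v d) = update-cong V≗W v d

  -- A derivation consults the valuation only in the tests of `cond`. Writing the target as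
  -- `effect α W` makes it reduce to `W` for actions, as `comm` demands of both premises.
  step-resp-≗ : ∀ {P V α P′ V′ W} → V ≗ W →
    (P , V) —[ α ]→ (P′ , V′) → (P , W) —[ α ]→ (P′ , effect α W)
  step-resp-≗ V≗W act          = act
  step-resp-≗ V≗W assign       = assign
  step-resp-≗ V≗W (cond e t)   = cond (trans (sym (V≗W _)) e) (step-resp-≗ V≗W t)
  step-resp-≗ V≗W (name t)     = name (step-resp-≗ V≗W t)
  step-resp-≗ V≗W (sumˡ t)     = sumˡ (step-resp-≗ V≗W t)
  step-resp-≗ V≗W (sumʳ t)     = sumʳ (step-resp-≗ V≗W t)
  step-resp-≗ V≗W (parˡ t)     = parˡ (step-resp-≗ V≗W t)
  step-resp-≗ V≗W (parʳ t)     = parʳ (step-resp-≗ V≗W t)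
  step-resp-≗ V≗W (encap b t)  = encap b (step-resp-≗ V≗W t)
  step-resp-≗ V≗W (comm t u e) = comm (step-resp-≗ V≗W t) (step-resp-≗ V≗W u) e

  step-≗ : ∀ {P V α P′ V′ W} → V ≗ W → (P , V) —[ α ]→ (P′ , V′) →
    ∃[ W′ ] ((P , W) —[ α ]→ (P′ , W′) × V′ ≗ W′)
  step-≗ {α = α} V≗W t with refl ← step-effect t =
    _ , step-resp-≗ V≗W t , effect-cong V≗W α

  ⟦⟧-resp-≗ : ∀ φ {P V W} → V ≗ W → (P , V) ∈ ⟦ φ ⟧ → (P , W) ∈ ⟦ φ ⟧
  ⟦⟧-resp-≗ true    V≗W p = p
  ⟦⟧-resp-≗ (v ≐ e) V≗W p = trans (sym (V≗W v)) p
  ⟦⟧-resp-≗ (¬′ φ)  V≗W p = p ∘ ⟦⟧-resp-≗ φ (sym ∘ V≗W)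
  ⟦⟧-resp-≗ (φ ∧ ψ) V≗W (p , q) = ⟦⟧-resp-≗ φ V≗W p , ⟦⟧-resp-≗ ψ V≗W q
  ⟦⟧-resp-≗ (φ ∨ ψ) V≗W = ⊎-map (⟦⟧-resp-≗ φ V≗W) (⟦⟧-resp-≗ ψ V≗W)
  ⟦⟧-resp-≗ (⟨ A ⟩ φ) V≗W (_ , α , p , α∈A , t)
    with W′ , t′ , V′≗W′ ← step-≗ V≗W t =
    _ , α , ⟦⟧-resp-≗ φ V′≗W′ p , α∈A , t′
  ⟦⟧-resp-≗ ([ A ] φ) V≗W p (P′ , W′) α α∈A t
    with V′ , t′ , W′≗V′ ← step-≗ (sym ∘ V≗W) t =
    ⟦⟧-resp-≗ φ (sym ∘ W′≗V′) (p _ α α∈A t′)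
  ⟦⟧-resp-≗ (↓[ v := e ] φ) V≗W p = ⟦⟧-resp-≗ φ (update-cong V≗W v e) p

  -- Induction on `φ` for all `V` at once: `↓` changes the valuation in place, which is harmless
  -- because `R` does not mention valuations.
  bisimilar⇒⟦⟧ : ∀ {R} → StatelessBisimulation R → ∀ φ {P Q} → R P Q → ∀ V →
    (P , V) ∈ ⟦ φ ⟧ ⇔ (Q , V) ∈ ⟦ φ ⟧
  bisimilar⇒⟦⟧ b true    r V = ⇔-id _
  bisimilar⇒⟦⟧ b false   r V = ⇔-id _
  bisimilar⇒⟦⟧ b (v ≐ e) r V = ⇔-id _
  bisimilar⇒⟦⟧ b (¬′ φ)  r V = ¬-cong-⇔ (bisimilar⇒⟦⟧ b φ r V)
  bisimilar⇒⟦⟧ b (φ ∧ ψ) r V = bisimilar⇒⟦⟧ b φ r V ×-⇔ bisimilar⇒⟦⟧ b ψ r V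
  bisimilar⇒⟦⟧ b (φ ∨ ψ) r V = bisimilar⇒⟦⟧ b φ r V ⊎-⇔ bisimilar⇒⟦⟧ b ψ r V
  bisimilar⇒⟦⟧ b (⟨ A ⟩ φ) {P} {Q} r V = mk⇔ f g
    where
    f : (P , V) ∈ ⟦ ⟨ A ⟩ φ ⟧ → (Q , V) ∈ ⟦ ⟨ A ⟩ φ ⟧
    f ((P′ , V′) , α , p , α∈A , t) with Q′ , u , r′ ← proj₁ (b r α V V′) P′ t =
      _ , α , to (bisimilar⇒⟦⟧ b φ r′ V′) p , α∈A , u
    g : (Q , V) ∈ ⟦ ⟨ A ⟩ φ ⟧ → (P , V) ∈ ⟦ ⟨ A ⟩ φ ⟧
    g ((Q′ , V′) , α , q , α∈A , u) with P′ , t , r′ ← proj₂ (b r α V V′) Q′ u =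
      _ , α , from (bisimilar⇒⟦⟧ b φ r′ V′) q , α∈A , t
  bisimilar⇒⟦⟧ b ([ A ] φ) {P} {Q} r V = mk⇔ f g
    where
    f : (P , V) ∈ ⟦ [ A ] φ ⟧ → (Q , V) ∈ ⟦ [ A ] φ ⟧
    f p (Q′ , V′) α α∈A u with P′ , t , r′ ← proj₂ (b r α V V′) Q′ u =
      to (bisimilar⇒⟦⟧ b φ r′ V′) (p _ α α∈A t)
    g : (Q , V) ∈ ⟦ [ A ] φ ⟧ → (P , V) ∈ ⟦ [ A ] φ ⟧
    g q (P′ , V′) α α∈A t with Q′ , u , r′ ← proj₁ (b r α V V′) P′ t =
      from (bisimilar⇒⟦⟧ b φ r′ V′) (q _ α α∈A u)
  bisimilar⇒⟦⟧ b (↓[ v := e ] φ) r V = bisimilar⇒⟦⟧ b φ r (V [ v ↦ e ])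

  ↓* : List Var → Valuation → Formula → Formula
  ↓* vs W φ = foldr (λ v → ↓[ v := W v ]_) φ vs

  -- Each assignment settles one more variable, so the current valuation need agree with `W` only
  -- outside the assignments still to come. At `[]` this is agreement everywhere.
  ⟦↓*⟧ : ∀ vs {P V W} φ → (∀ w → w ∉ˡ vs → V w ≡ W w) →
    (P , V) ∈ ⟦ ↓* vs W φ ⟧ ⇔ (P , W) ∈ ⟦ φ ⟧
  ⟦↓*⟧ [] φ agree =
    mk⇔ (⟦⟧-resp-≗ φ λ w → agree w λ ()) (⟦⟧-resp-≗ φ λ w → sym (agree w λ ()))
  ⟦↓*⟧ (v ∷ vs) {P} {V} {W} φ agree = ⟦↓*⟧ vs φ agree′
    where
    agree′ : ∀ w → w ∉ˡ vs → (V [ v ↦ W v ]) w ≡ W w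
    agree′ w w∉vs with does (w ≟ᵛ v) | proof (w ≟ᵛ v)
    ... | true  | ofʸ refl = refl
    ... | false | ofⁿ w≢v  = agree w λ where
      (here w≡v)   → w≢v w≡v
      (there w∈vs) → w∉vs w∈vs

  vars : List Var
  vars = map (Inverse.from Var↔Fin) (allFin numVars)

  ∈-vars : ∀ v → v ∈ˡ vars
  ∈-vars v = subst (_∈ˡ vars) (Inverse.strictlyInverseʳ Var↔Fin v)
    (∈-map⁺ (Inverse.from Var↔Fin) (∈-allFin (Inverse.to Var↔Fin v)))

  ⟦↓vars⟧ : ∀ {P V W} φ → (P , V) ∈ ⟦ ↓* vars W φ ⟧ ⇔ (P , W) ∈ ⟦ φ ⟧
  ⟦↓vars⟧ φ = ⟦↓*⟧ vars φ λ w w∉ → ⊥-elim (w∉ (∈-vars w))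

  infix 4 _≋_
  _≋_ : Process → Process → Set
  P ≋ Q = ∀ V φ → (P , V) ∈ ⟦ φ ⟧ ⇔ (Q , V) ∈ ⟦ φ ⟧

  ≋-sym : ∀ {P Q} → P ≋ Q → Q ≋ P
  ≋-sym e V φ = ⇔-sym (e V φ)

  Separates : Formula → State → State → Set
  Separates φ s u = s ∈ ⟦ φ ⟧ × u ∉ ⟦ φ ⟧

  -- The separating formulas are conjoined; `true` serves when there are no candidates.
  separate-all : ∀ s us → (∀ u → u ∈ˡ us → ∃[ φ ] Separates φ s u) →
    ∃[ φ ] (s ∈ ⟦ φ ⟧ × (∀ u → u ∈ˡ us → u ∉ ⟦ φ ⟧))
  separate-all s [] sep = true , _ , λ _ ()
  separate-all s (u ∷ us) sep
    with φ , p , ¬q ← sep u (here refl)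
       | ψ , p′ , ¬q′ ← separate-all s us (λ w → sep w ∘ there) =
    φ ∧ ψ , (p , p′) , λ where
      _ (here refl) → ¬q ∘ proj₁
      w (there w∈)  → ¬q′ w w∈ ∘ proj₂

  image-finite-step : ∀ {P V α P′ V′} →
    ImageFinite P → (P , V) —[ α ]→ (P′ , V′) → ImageFinite P′
  image-finite-step fin t P″ r = fin P″ ((_ , _ , _ , t) ◅ r)

  module Classical (em : ExcludedMiddle 0ℓ) where

    dne : {A : Set} → ¬ ¬ A → A
    dne = em⇒dne em

    separate : ∀ {P Q} V → ¬ P ≋ Q → ∃[ φ ] Separates φ (P , V) (Q , V)
    separate V ¬P≋Q = dne λ ¬sep → ¬P≋Q λ W φ → mk⇔
      (λ p → dne λ ¬q → ¬sep
        (↓* vars W φ , from (⟦↓vars⟧ φ) p , ¬q ∘ to (⟦↓vars⟧ φ)))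
      -- Here `φ` holds on the side of `Q` only, so its negation separates in the required
      -- direction.
      (λ q → dne λ ¬p → ¬sep
        (↓* vars W (¬′ φ) , from (⟦↓vars⟧ (¬′ φ)) ¬p ,
          λ ¬q → to (⟦↓vars⟧ (¬′ φ)) ¬q q))

    match : ∀ {P Q α V P′ V′} → ImageFinite Q → P ≋ Q →
      (P , V) —[ α ]→ (P′ , V′) →
      ∃[ Q′ ] ((Q , V) —[ α ]→ (Q′ , V′) × P′ ≋ Q′)
    match {P} {Q} {α} {V} {P′} {V′} finQ P≋Q t = dne impossible
      where
      Match : Set
      Match = ∃[ Q′ ] ((Q , V) —[ α ]→ (Q′ , V′) × P′ ≋ Q′)

      separate-successor : ¬ Match → ∀ {u} → (Q , V) —[ α ]→ u →
        ∃[ φ ] Separates φ (P′ , V′) u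
      separate-successor ¬match u
        -- The two successors share the valuation `V′`, so they can differ only in their processes.
        with refl ← trans (step-effect u) (sym (step-effect t)) =
        separate V′ λ P′≋Q′ → ¬match (_ , u , P′≋Q′)

      impossible : ¬ ¬ Match
      impossible ¬match
        with us , enum ← finQ Q ε V α
        with φ , p , ¬q ← separate-all (P′ , V′) us
               (λ u → separate-successor ¬match ∘ from (enum u))
        -- The step `t` makes the diamond true at `P`, hence at `Q`; its witness there is one of the
        -- enumerated successors, all of which refute `φ`.
        with u , _ , q , here refl , t′ ←
          to (P≋Q V (⟨ α ∷ [] ⟩ φ)) (_ , α , p , here refl , t) =
        ¬q u (to (enum u) t′) q

    -- Image-finiteness is part of the relation because `match` needs it again at each pair of
    -- successors, which inherit it.
    LogicallyEquivalent : Process → Process → Set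
    LogicallyEquivalent P Q = ImageFinite P × ImageFinite Q × P ≋ Q

    logical-bisimulation : StatelessBisimulation LogicallyEquivalent
    logical-bisimulation (finP , finQ , P≋Q) α V V′ =
      (λ P′ t → let Q′ , u , e = match finQ P≋Q t in
        Q′ , u , image-finite-step finP t , image-finite-step finQ u , e) ,
      (λ Q′ u → let P′ , t , e = match finP (≋-sym P≋Q) u in
        P′ , t , image-finite-step finP t , image-finite-step finQ u , ≋-sym e)

theorem11 : ExcludedMiddle 0ℓ →
    (S : Signature) (E : Specification S) →
    let open Semantics S E in
    (P Q : Process) → ImageFinite P → ImageFinite Q →
    StatelessBisimilar P Q ⇔
    ((V : Valuation) (φ : Formula) → (P , V) ∈ ⟦ φ ⟧ ⇔ (Q , V) ∈ ⟦ φ ⟧)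
theorem11 em S E P Q finP finQ = mk⇔
  (λ (R , b , r) V φ → bisimilar⇒⟦⟧ b φ r V)
  (λ P≋Q → LogicallyEquivalent , (λ {_} {_} → logical-bisimulation) , finP , finQ , P≋Q)
  where
  open Properties S E
  open Classical em
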